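{- Every locally out-transitive oriented graph has dichromatic number at most 2.
   Context: An oriented graph is a digraph with no loops, no parallel arcs and no pair of opposite arcs. It is locally out-transitive if the out-neighbourhood of every vertex induces a transitive (i.e. acyclic) tournament. The dichromatic number is the least number of parts in a partition of the vertex set into sets inducing acyclic subdigraphs. -}

module Defs where

open import Level using (Level; _⊔_) renaming (suc to lsuc; zero to lzero)
open import Data.Nat using (ℕ)
open import Data.Fin using (Fin)
open import Data.Product using (_×_; Σ; ∃; _,_)
open import Data.Sum using (_⊎_)
open import Relation.Nullary using (¬_; Dec)
open import Relation.Binary.PropositionalEquality using (_≡_)

record Digraph : Set₁ where
  field
    n    : ℕ
    Arc  : Fin n → Fin n → Set
    arc? : ∀ u v → Dec (Arc u v)

module _ (G : Digraph) where
  open Digraph G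

  -- no loops and no pair of opposite arcs (parallel arcs cannot occur in this
  -- representation)
  Oriented : Set
  Oriented = (∀ v → ¬ Arc v v) × (∀ u v → Arc u v → ¬ Arc v u)

  data WalkIn (S : Fin n → Set) : Fin n → Fin n → Set where
    step : ∀ {u v} → S u → S v → Arc u v → WalkIn S u v
    _∷_  : ∀ {u v w} → S u → Arc u v → WalkIn S v w → WalkIn S u w

  -- the subdigraph induced by S is acyclic: it has no directed cycle
  -- (equivalently, no closed directed walk of positive length)
  AcyclicIn : (Fin n → Set) → Set
  AcyclicIn S = ∀ v → ¬ WalkIn S v v

  TournamentIn : (Fin n → Set) → Set
  TournamentIn S = ∀ u w → S u → S w → ¬ u ≡ w → Arc u w ⊎ Arc w u

  -- S induces a transitive (= acyclic) tournament
  TransitiveTournamentIn : (Fin n → Set) → Set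
  TransitiveTournamentIn S = TournamentIn S × AcyclicIn S

  OutNbr : Fin n → Fin n → Set
  OutNbr v u = Arc v u

  LocallyOutTransitive : Set
  LocallyOutTransitive = ∀ v → TransitiveTournamentIn (OutNbr v)

  AcyclicColouring : ℕ → Set
  AcyclicColouring k =
    Σ (Fin n → Fin k) λ c → ∀ (i : Fin k) → AcyclicIn (λ v → c v ≡ i)

  DichromaticAtMost : ℕ → Set
  DichromaticAtMost k = AcyclicColouring k

{-# OPTIONS --safe #-}
module Submission where

open import Defs
open import Data.Bool using (Bool; true; false; not)
open import Data.Bool.Properties using (not-¬) renaming (_≟_ to _≟ᵇ_)
open import Data.Empty using (⊥; ⊥-elim)
open import Data.Fin using (Fin; zero; suc; toℕ)
open import Data.Fin.Properties using (_≟_; any?; pigeonhole; toℕ<n)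
open import Data.List using (List; []; _∷_; length; filter; allFin)
open import Data.List.Membership.Propositional using (_∈_; lose)
open import Data.List.Membership.Propositional.Properties using (∈-filter⁺; ∈-allFin)
open import Data.List.Properties using (filter-notAll)
open import Data.List.Relation.Unary.Any using (here; there)
open import Data.Nat using (ℕ; zero; suc; _+_; _*_; _∸_; _≤_; _<_; z≤n; s≤s; z<s; s<s; _<?_)
open import Data.Nat.GeneralisedArithmetic using (fold; fold-+)
open import Data.Nat.Induction using (<-wellFounded)
open import Data.Nat.Properties hiding (_≟_)
open import Data.Product using (Σ; ∃; ∃₂; _×_; _,_; proj₁; proj₂)
open import Data.Sum using (_⊎_; inj₁; inj₂; [_,_]′)
open import Function using (_∘_; case_of_)
open import Induction.WellFounded using (Acc; acc)
open import Relation.Binary.Construct.Closure.ReflexiveTransitive using (Star; ε; _◅_; _◅◅_)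
open import Relation.Binary.Definitions using (tri<; tri≈; tri>)
open import Relation.Binary.PropositionalEquality
  using (_≡_; _≢_; refl; sym; trans; cong; subst; subst₂; ≢-sym; module ≡-Reasoning)
open import Relation.Nullary using (¬_; Dec; yes; no)
open import Relation.Nullary.Decidable using (¬?; _×-dec_)

-- Partition the vertices into classes whose members share all out-neighbours outside
-- the class, starting with singletons. The out-neighbours leaving a class form a
-- transitive tournament; let the class containing its source be the next one. An arc
-- leaving a class either enters the next class or also leaves the next class, so arcs
-- can be slid along "next". If "next" has a cycle, the union of its classes is again a
-- class; if not, arcs between classes follow "next" towards sinks, and the classes can
-- be coloured independently.
--
-- The invariant that survives a merge: for every v, the class has an acyclic
-- 2-colouring that is constant on v and its out-neighbours in the class. All arcs
-- entering a class c, other than that of v, from the rest of the cycle end in out-neighbours of its predecessor,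
-- hence in a closed out-neighbourhood within c, which can be given one prescribed
-- colour. Starting from the class of v, this colour is b up to the first class with a
-- backward arc and the opposite colour from there on, so that a monochromatic walk moves
-- through the classes in one direction only.

-- Least witnesses and minimal periods of iterated maps.

least : {P : ℕ → Set} → (∀ k → Dec (P k)) → ∀ k → P k →
        ∃ λ m → m ≤ k × P m × (∀ {j} → j < m → ¬ P j)
least P? zero    pk = 0 , z≤n , pk , λ ()
least P? (suc k) pk with P? 0
... | yes p0 = 0 , z≤n , p0 , λ ()
... | no ¬p0 with least (P? ∘ suc) k pk
...   | m , m≤k , pm , min =
  suc m , s≤s m≤k , pm , λ { {zero} _ → ¬p0 ; {suc j} (s≤s j<m) → min j<m }

module _ {A : Set} (F : A → A) where

  -- The minimal period is `suc k`: it is positive by construction, and `k` is zero exactly at a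
  -- fixed point.
  record Period (x : A) (k : ℕ) : Set where
    field
      returns : fold x F (suc k) ≡ x
      minimal : ∀ {j} → j < k → fold x F (suc j) ≢ x

  module PeriodProperties {x : A} {k : ℕ} (per : Period x k) where
    open Period per

    orbit : ℕ → A
    orbit = fold x F

    orbit-+ : ∀ t → orbit (t + suc k) ≡ orbit t
    orbit-+ t = trans (fold-+ x F t) (cong (λ z → fold z F t) returns)

    orbit-+* : ∀ a t → orbit (t + a * suc k) ≡ orbit t
    orbit-+* zero    t = cong orbit (+-identityʳ t)
    orbit-+* (suc a) t = begin
      orbit (t + (suc k + a * suc k)) ≡⟨ cong orbit (cong (t +_) (+-comm (suc k) (a * suc k))) ⟩
      orbit (t + (a * suc k + suc k)) ≡⟨ cong orbit (+-assoc t (a * suc k) (suc k)) ⟨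
      orbit (t + a * suc k + suc k)   ≡⟨ orbit-+ (t + a * suc k) ⟩
      orbit (t + a * suc k)           ≡⟨ orbit-+* a t ⟩
      orbit t ∎
      where open ≡-Reasoning

    orbit-fold : ∀ a m → fold (orbit a) F m ≡ orbit (m + a)
    orbit-fold a m = sym (fold-+ x F m)

    -- A further `a * k` steps take position `a` to a multiple of the period, hence to `x`, so a
    -- repetition at `a` would yield one of the same length at `x`.
    distinct : ∀ a {r} → r < k → orbit (suc r + a) ≢ orbit a
    distinct a {r} r<k eq = minimal r<k (begin
      orbit (suc r)                      ≡⟨ orbit-+* a (suc r) ⟨
      orbit (suc r + a * suc k)          ≡⟨ cong orbit arith ⟨
      orbit (a * k + (suc r + a))        ≡⟨ orbit-fold (suc r + a) (a * k) ⟨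
      fold (orbit (suc r + a)) F (a * k) ≡⟨ cong (λ z → fold z F (a * k)) eq ⟩
      fold (orbit a) F (a * k)           ≡⟨ orbit-fold a (a * k) ⟩
      orbit (a * k + a)                  ≡⟨ cong orbit (trans (+-comm (a * k) a) (sym (*-suc a k))) ⟩
      orbit (a * suc k)                  ≡⟨ orbit-+* a 0 ⟩
      x ∎)
      where
      open ≡-Reasoning
      arith : a * k + (suc r + a) ≡ suc r + a * suc k
      arith = begin
        a * k + (suc r + a) ≡⟨ +-comm (a * k) (suc r + a) ⟩
        suc r + a + a * k   ≡⟨ +-assoc (suc r) a (a * k) ⟩
        suc r + (a + a * k) ≡⟨ cong (suc r +_) (*-suc a k) ⟨
        suc r + a * suc k ∎

    distinct-window : ∀ {a b} → a < b → b < a + suc k → orbit b ≢ orbit a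
    distinct-window {a} {b} a<b b<a+k with m≤n⇒∃[o]m+o≡n a<b
    ... | r , refl = subst (λ z → orbit z ≢ orbit a) (cong suc (+-comm r a))
            (distinct a (≤-pred (+-cancelˡ-< a (suc r) (suc k) (subst (_< a + suc k) (sym (+-suc a r)) b<a+k))))

    orbit-injective : ∀ {a b} → a < suc k → b < suc k → orbit a ≡ orbit b → a ≡ b
    orbit-injective {a} {b} a<k b<k eq with <-cmp a b
    ... | tri< a<b _ _ = ⊥-elim (distinct-window a<b (<-≤-trans b<k (m≤n+m (suc k) a)) (sym eq))
    ... | tri≈ _ a≡b _ = a≡b
    ... | tri> _ _ b<a = ⊥-elim (distinct-window b<a (<-≤-trans a<k (m≤n+m (suc k) b)) eq)

    orbit-reduce : ∀ t → ∃ λ r → r < suc k × orbit r ≡ orbit t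
    orbit-reduce zero = 0 , z<s , refl
    orbit-reduce (suc t) with orbit-reduce t
    ... | r , r<k , eq with m≤n⇒m<n∨m≡n r<k
    ...   | inj₁ sr<k = suc r , sr<k , cong F eq
    ...   | inj₂ refl = 0 , z<s , trans (sym returns) (cong F eq)

    orbit-shift : ∀ s u → ∃ λ t → fold (orbit s) F t ≡ orbit u
    -- The extra `s * k` steps complete the offset `s` to `s` full rounds.
    orbit-shift s u = u + s * k , (begin
      fold (orbit s) F (u + s * k) ≡⟨ orbit-fold s (u + s * k) ⟩
      orbit (u + s * k + s)        ≡⟨ cong orbit (+-assoc u (s * k) s) ⟩
      orbit (u + (s * k + s))      ≡⟨ cong (λ z → orbit (u + z)) (trans (+-comm (s * k) s) (sym (*-suc s k))) ⟩
      orbit (u + s * suc k)        ≡⟨ orbit-+* s u ⟩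
      orbit u ∎)
      where open ≡-Reasoning

    shifted : ∀ s → Period (orbit s) k
    shifted s = record
      { returns = trans (orbit-fold s (suc k)) (trans (cong orbit (+-comm (suc k) s)) (orbit-+ s))
      ; minimal = λ {j} j<k → distinct s j<k ∘ trans (sym (orbit-fold s (suc j)))
      }

-- Two of the iterates from 0 to `n` coincide, so the orbit is on its cycle by step `n`: the
-- coincidence, pushed forward to that point, gives a return, and `least` gives the first one.
eventually-periodic : ∀ {n} (F : Fin n → Fin n) (x : Fin n) → ∃ (Period F (fold x F n))
eventually-periodic {n} F x with pigeonhole (n<1+n n) (λ i → fold x F (toℕ i))
... | i , j , i<j , eq with m≤n⇒∃[o]m+o≡n i<j
...   | r , si+r≡j with least (λ m → fold y F (suc m) ≟ y) r ret
  where
  open ≡-Reasoning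
  y = fold x F n
  ret : fold y F (suc r) ≡ y
  ret = begin
    fold y F (suc r)                          ≡⟨ fold-+ x F (suc r) ⟨
    fold x F (suc r + n)                      ≡⟨ cong (λ z → fold x F (suc r + z)) (m∸n+n≡m i≤n) ⟨
    fold x F (suc r + (n ∸ toℕ i + toℕ i))    ≡⟨ cong (fold x F) arith ⟩
    fold x F (n ∸ toℕ i + toℕ j)              ≡⟨ fold-+ x F (n ∸ toℕ i) ⟩
    fold (fold x F (toℕ j)) F (n ∸ toℕ i)     ≡⟨ cong (λ z → fold z F (n ∸ toℕ i)) eq ⟨
    fold (fold x F (toℕ i)) F (n ∸ toℕ i)     ≡⟨ fold-+ x F (n ∸ toℕ i) ⟨
    fold x F (n ∸ toℕ i + toℕ i)              ≡⟨ cong (fold x F) (m∸n+n≡m i≤n) ⟩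
    y ∎
    where
    i≤n : toℕ i ≤ n
    i≤n = ≤-pred (toℕ<n i)
    arith : suc r + (n ∸ toℕ i + toℕ i) ≡ n ∸ toℕ i + toℕ j
    arith = begin
      suc r + (n ∸ toℕ i + toℕ i) ≡⟨ +-comm (suc r) _ ⟩
      n ∸ toℕ i + toℕ i + suc r   ≡⟨ +-assoc (n ∸ toℕ i) (toℕ i) (suc r) ⟩
      n ∸ toℕ i + (toℕ i + suc r) ≡⟨ cong (n ∸ toℕ i +_) (trans (+-suc (toℕ i) r) si+r≡j) ⟩
      n ∸ toℕ i + toℕ j ∎
...     | m , _ , returns , minimal = m , record { returns = returns ; minimal = minimal }

-- Closed walks and their crossings between classes.

module _ (G : Digraph) where
  open Digraph G renaming (n to order)

  private
    V : Set
    V = Fin order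

  Step : (V → Set) → V → V → Set
  Step S u w = S u × S w × Arc u w

  walk-map : {S T : V → Set} → (∀ {x} → S x → T x) → ∀ {u w} → WalkIn G S u w → WalkIn G T u w
  walk-map f (step su sw a)  = step (f su) (f sw) a
  walk-map f (_∷_ su a walk) = _∷_ (f su) a (walk-map f walk)

  head-in : ∀ {S u w} → WalkIn G S u w → S u
  head-in (step su _ _) = su
  head-in (_∷_ su _ _)  = su

  module _ (cls : V → V) where

    Crossing : (V → Set) → V → V → Set
    Crossing S u w = ∃₂ λ x y → Star (Step S) u x × Step S x y × cls x ≢ cls y × Star (Step S) y w

    walk→star : ∀ {S u w} → WalkIn G S u w → Star (Step S) u w
    walk→star (step su sw a)  = (su , sw , a) ◅ ε
    walk→star (_∷_ su a walk) = (su , head-in walk , a) ◅ walk→star walk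

    stays-or-crosses : ∀ {S u w} → WalkIn G S u w →
                       WalkIn G (λ x → cls x ≡ cls u × S x) u w ⊎ Crossing S u w
    stays-or-crosses {u = u} {w} (step su sw a) with cls u ≟ cls w
    ... | yes eq = inj₁ (step (refl , su) (sym eq , sw) a)
    ... | no neq = inj₂ (_ , _ , ε , (su , sw , a) , neq , ε)
    stays-or-crosses {u = u} (_∷_ {v = v} su a walk) with cls u ≟ cls v
    ... | no neq = inj₂ (_ , _ , ε , (su , head-in walk , a) , neq , walk→star walk)
    ... | yes eq with stays-or-crosses walk
    ...   | inj₁ inside = inj₁ (_∷_ (refl , su) a (walk-map (λ (e , s) → trans e (sym eq) , s) inside))
    ...   | inj₂ (x , y , before , rest) =
      inj₂ (x , y , (su , head-in walk , a) ◅ before , rest)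

    -- A closed walk that leaves the class of its start can be rotated to begin with a step between
    -- classes.
    closed-walk : ∀ {S u} → WalkIn G S u u →
                  WalkIn G (λ x → cls x ≡ cls u × S x) u u ⊎
                  ∃₂ λ x y → Step S x y × cls x ≢ cls y × Star (Step S) y x
    closed-walk walk with stays-or-crosses walk
    ... | inj₁ inside = inj₁ inside
    ... | inj₂ (x , y , before , s , neq , after) = inj₂ (x , y , s , neq , after ◅◅ before)

    -- I may fail at the class where a walk starts, but holds once a class has been
    -- entered from another one; a closed walk may be started at such an entry.
    acyclic-by-position :
      {S : V → Set} (I : ℕ → Set) (pos : V → ℕ) →
      (∀ {x y} → Step S x y → cls x ≢ cls y →
         I (pos (cls y)) × (I (pos (cls x)) → pos (cls x) < pos (cls y))) →
      (∀ u → ¬ WalkIn G (λ x → cls x ≡ cls u × S x) u u) →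
      AcyclicIn G S
    acyclic-by-position {S} I pos crossing inner u walk with closed-walk walk
    ... | inj₁ inside = inner u inside
    ... | inj₂ (x , y , s , neq , back) with climb back (proj₁ (crossing s neq))
      where
      climb : ∀ {y x} → Star (Step S) y x → I (pos (cls y)) →
              I (pos (cls x)) × pos (cls y) ≤ pos (cls x)
      climb ε i = i , ≤-refl
      climb (_◅_ {i = y} {j = z} s rest) i with cls y ≟ cls z
      ... | yes eq rewrite eq = climb rest i
      ... | no neq with crossing s neq
      ...   | iz , y<z with climb rest iz
      ...     | ix , z≤x = ix , ≤-trans (<⇒≤ (y<z i)) z≤x
    ... | ix , y≤x = <⇒≱ (proj₂ (crossing s neq) ix) y≤x

  -- Partitions with the invariant, and the discrete one.

  GoodColouring : (V → V) → V → Bool → Set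
  GoodColouring p v b = Σ (V → Bool) λ col →
    col v ≡ b ×
    (∀ {u} → p u ≡ p v → Arc v u → col u ≡ b) ×
    (∀ β → AcyclicIn G (λ u → p u ≡ p v × col u ≡ β))

  -- Classes are the fibres of a map to representatives, so a map between classes can be iterated as
  -- a map on vertices.
  record ModularPartition : Set where
    field
      p          : V → V
      idempotent : ∀ x → p (p x) ≡ p x
      uniform    : ∀ {x x′ y} → p x ≡ p x′ → p y ≢ p x → Arc x y → Arc x′ y
      good       : ∀ v b → GoodColouring p v b

  module _ (oriented : Oriented G) (lot : LocallyOutTransitive G) where

    asym : ∀ {u w} → Arc u w → ¬ Arc w u
    asym = proj₂ oriented _ _

    discrete : ModularPartition
    discrete = record
      { p          = λ x → x
      ; idempotent = λ _ → refl
      ; uniform    = λ { refl _ a → a }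
      ; good       = λ v b → (λ _ → b) , refl , (λ _ _ → refl) , λ β u walk → no-walk walk
      }
      where
      no-walk : ∀ {v u w} {Q : V → Set} → ¬ WalkIn G (λ x → x ≡ v × Q x) u w
      no-walk (step (refl , _) (refl , _) a)  = asym a a
      no-walk (_∷_ (refl , _) a walk) with head-in walk
      ... | refl , _ = asym a a

    -- Sources of sets of out-neighbours.

    Source : (V → Set) → V → Set
    Source P w = P w × (∀ {z} → P z → z ≡ w ⊎ Arc w z)

    module _ (x : V) {P : V → Set} (P? : ∀ y → Dec (P y)) (P⊆N : ∀ {y} → P y → Arc x y) where

      private
        tournament : ∀ {u w} → P u → P w → u ≢ w → Arc u w ⊎ Arc w u
        tournament pu pw = proj₁ (lot x) _ _ (P⊆N pu) (P⊆N pw)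

        transitive : ∀ {u w z} → P u → P w → P z → Arc u w → Arc w z → Arc u z
        transitive {u} {w} {z} pu pw pz uw wz with u ≟ z
        ... | yes refl = ⊥-elim (asym uw wz)
        ... | no u≢z with tournament pu pz u≢z
        ...   | inj₁ uz = uz
        ...   | inj₂ zu = ⊥-elim (proj₂ (lot x) u
                (_∷_ (P⊆N pu) uw (_∷_ (P⊆N pw) wz (step (P⊆N pz) (P⊆N pu) zu))))

        Within : List V → V → Set
        Within l y = P y × y ∈ l

        -- A new element either is dominated by the old source or dominates it, and then by
        -- transitivity also all that the old source dominates.
        source-within : ∀ l → ∃ (Source (Within l)) ⊎ (∀ {y} → ¬ Within l y)
        source-within [] = inj₂ λ ()
        source-within (a ∷ l) with P? a | source-within l
        ... | no ¬pa | inj₂ none = inj₂ λ { (py , here refl) → ¬pa py ; (py , there y∈l) → none (py , y∈l) }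
        ... | no ¬pa | inj₁ (w , (pw , w∈l) , src) = inj₁ (w , (pw , there w∈l) ,
                λ { (pz , here refl) → ⊥-elim (¬pa pz) ; (pz , there z∈l) → src (pz , z∈l) })
        ... | yes pa | inj₂ none = inj₁ (a , (pa , here refl) ,
                λ { (_ , here refl) → inj₁ refl ; (pz , there z∈l) → ⊥-elim (none (pz , z∈l)) })
        ... | yes pa | inj₁ (w , (pw , w∈l) , src) with a ≟ w
        ...   | yes refl = inj₁ (a , (pa , here refl) ,
                λ { (_ , here refl) → inj₁ refl ; (pz , there z∈l) → src (pz , z∈l) })
        ...   | no a≢w with tournament pa pw a≢w
        ...     | inj₂ wa = inj₁ (w , (pw , there w∈l) ,
                  λ { (_ , here refl) → inj₂ wa ; (pz , there z∈l) → src (pz , z∈l) })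
        ...     | inj₁ aw = inj₁ (a , (pa , here refl) , λ
                  { (_ , here refl) → inj₁ refl
                  ; (pz , there z∈l) → inj₂ ([ (λ { refl → aw }) , transitive pa pw pz aw ]′ (src (pz , z∈l)))
                  })

      source? : ∃ (Source P) ⊎ (∀ {y} → ¬ P y)
      source? with source-within (allFin order)
      ... | inj₁ (w , (pw , _) , src) = inj₁ (w , pw , λ pz → src (pz , ∈-allFin _))
      ... | inj₂ none                 = inj₂ λ py → none (py , ∈-allFin _)

    -- The map `next` between classes and the sliding of arcs.

    module Quotient (π : ModularPartition) where
      open ModularPartition π public

      Exit : V → V → Set
      Exit x y = Arc x y × p y ≢ p x

      first-exit? : ∀ x → ∃ (Source (Exit x)) ⊎ (∀ {y} → ¬ Exit x y)
      first-exit? x = source? x (λ y → arc? x y ×-dec ¬? (p y ≟ p x)) proj₁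

      -- A vertex without exits is fixed, so a representative is a fixed point exactly when no arc
      -- leaves its class.
      next : V → V
      next x with first-exit? x
      ... | inj₁ (w , _) = p w
      ... | inj₂ _       = x

      moves : ∀ {x} → next x ≢ x → Σ V λ w → Source (Exit x) w × p w ≡ next x
      moves {x} nx≢x with first-exit? x
      ... | inj₁ (w , src) = w , src , refl
      ... | inj₂ _         = ⊥-elim (nx≢x refl)

      exit-moves : ∀ {x y} → p x ≡ x → Exit x y → next x ≢ x
      exit-moves {x} px≡x e with first-exit? x
      ... | inj₁ (w , (_ , pw≢px) , _) = λ eq → pw≢px (trans eq (sym px≡x))
      ... | inj₂ none                  = ⊥-elim (none e)

      next-rep : ∀ {x} → p x ≡ x → p (next x) ≡ next x
      next-rep {x} px≡x with first-exit? x
      ... | inj₁ (w , _) = idempotent w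
      ... | inj₂ _       = px≡x

      orbit-rep : ∀ {x} → p x ≡ x → ∀ t → p (fold x next t) ≡ fold x next t
      orbit-rep px≡x zero    = px≡x
      orbit-rep px≡x (suc t) = next-rep (orbit-rep px≡x t)

      from-rep : ∀ {x y} → Exit x y → Exit (p x) y
      from-rep {x} (a , neq) = uniform (sym (idempotent x)) neq a , neq ∘ (λ e → trans e (idempotent x))

      -- The source `w` of the exits of `x` lies in the class of `next x`. Since `y` is another
      -- exit, `w` dominates it, and uniformity moves the tail from `w` to the representative.
      slide : ∀ {x y} → p x ≡ x → Exit x y → p y ≢ next x → Exit (next x) y
      slide {x} {y} px≡x e py≢ with moves (exit-moves px≡x e)
      ... | w , (_ , src) , pw≡ with src e
      ...   | inj₁ refl = ⊥-elim (py≢ pw≡)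
      ...   | inj₂ wy   = subst (λ z → Exit z y) pw≡ (from-rep (wy , λ eq → py≢ (trans eq pw≡)))

      -- Uniformity moves both tails, giving arcs from `y` to `z` and from `z` to `y`.
      antisym : ∀ {i l y z} → p i ≡ i → p l ≡ l → Exit i y → p y ≡ l → Exit l z → p z ≡ i → ⊥
      antisym {i} {l} {y} {z} pi pl (iy , y∉i) y∈l (lz , z∉l) z∈i =
        asym (uniform (trans pl (sym y∈l)) z∉l lz)
             (uniform (trans pi (sym z∈i)) y∉i iy)

      -- Colouring the union of the classes on a cycle of `next`.

      module Cycle (v : V) (b : Bool) {k : ℕ} (0<k : 0 < k) (period : Period next (p v) k) where
        open Period period
        open PeriodProperties next period renaming (orbit to c)

        N : ℕ
        N = suc k

        rep : ∀ t → p (c t) ≡ c t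
        rep = orbit-rep (idempotent v)

        c-moves : ∀ t → next (c t) ≢ c t
        c-moves t = distinct t 0<k

        class-exit : ∀ {x y} i → p x ≡ c i → p x ≢ p y → Arc x y → Exit (c i) y
        class-exit i x∈i neq a =
          uniform (trans x∈i (sym (rep i))) (≢-sym neq) a , λ eq → neq (trans x∈i (trans (sym (rep i)) (sym eq)))

        -- Strictly between positions `l` and `l + N` the class `c l` does not recur, so no slide
        -- runs into the class of `y`.
        advance : ∀ {l i y} m → l < i → m + i < l + N → p y ≡ c l → Exit (c i) y → Exit (c (m + i)) y
        advance zero l<i _ _ e = e
        advance {l} {i} (suc m) l<i lt y∈l e =
          slide (rep (m + i)) (advance m l<i (<-trans (n<1+n _) lt) y∈l e)
            (λ eq → distinct-window (<-≤-trans l<i (m≤n+m i (suc m))) lt (trans (sym eq) y∈l))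

        travel : ∀ {l i j y} → l < i → i ≤ j → j < l + N → p y ≡ c l → Exit (c i) y → Exit (c j) y
        travel {l} {i} {j} l<i i≤j j<l+N y∈l e =
          subst (λ m → Exit (c m) _) (m∸n+n≡m i≤j)
            (advance (j ∸ i) l<i (subst (_< l + N) (sym (m∸n+n≡m i≤j)) j<l+N) y∈l e)

        enters-from-predecessor : ∀ {i t y} → i < N → suc t < N → p y ≡ c (suc t) → Exit (c i) y → Exit (c t) y
        enters-from-predecessor {i} {t} {y} i<N st<N y∈ e@(_ , y∉i) =
          subst (λ z → Exit z y) (orbit-+ t) around
          where
          around : Exit (c (t + N)) y
          around with <-cmp i (suc t)
          ... | tri≈ _ refl _ = ⊥-elim (y∉i (trans y∈ (sym (rep i))))
          ... | tri> _ _ st<i = travel st<i (≤-trans (<⇒≤ i<N) (m≤n+m N t)) ≤-refl y∈ e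
          -- The start is read one round later, as `i + N`, to lie above the position `suc t` of the
          -- target.
          ... | tri< (s≤s i≤t) _ _ =
            travel (<-≤-trans st<N (m≤n+m N i)) (+-monoˡ-≤ N i≤t) ≤-refl y∈
                   (subst (λ z → Exit z y) (sym (orbit-+ i)) e)

        Backward : ℕ → Set
        Backward i = ∃ λ l → l < i × ∃ λ y → Exit (c i) y × p y ≡ c l

        backward? : ∀ i → Dec (Backward i)
        backward? i with anyUpTo? (λ l → any? (λ y → (arc? (c i) y ×-dec ¬? (p y ≟ p (c i))) ×-dec (p y ≟ c l))) i
        ... | yes (l , l<i , y) = yes (l , l<i , y)
        ... | no ¬back          = no λ (l , l<i , y) → ¬back (l , l<i , y)

        -- The first exit of the last class enters `c 0`, which closes the cycle.
        last-backward : Backward k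
        last-backward with moves (c-moves k)
        ... | w , (e , _) , w∈ = 0 , 0<k , w , e , trans w∈ returns

        abstract
          first-backward : ∃ λ m → m ≤ k × Backward m × (∀ {j} → j < m → ¬ Backward j)
          first-backward = least backward? k last-backward

        q : ℕ
        q = proj₁ first-backward

        q<N : q < N
        q<N = s≤s (proj₁ (proj₂ first-backward))

        q-backward : Backward q
        q-backward = proj₁ (proj₂ (proj₂ first-backward))

        forward-below-q : ∀ {i} → i < q → ¬ Backward i
        forward-below-q = proj₂ (proj₂ (proj₂ first-backward))

        0<q : 0 < q
        0<q = ≤-<-trans z≤n (proj₁ (proj₂ q-backward))

        -- Let c q → c j be the first backward arc. Sliding it to c l and sliding the arc from
        -- c i on to c j gives arcs between c l and c j in both directions.
        forward-above-q : ∀ {i l y} → q ≤ l → l < i → i ≤ N → Exit (c i) y → p y ≡ c l → ⊥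
        forward-above-q {i} {l} {y} q≤l l<i i≤N e y∈l with q-backward
        ... | j , j<q , z , e′ , z∈j =
          antisym (rep j) (rep l)
            (subst (λ x → Exit x y) (orbit-+ j)
              (travel l<i (≤-trans i≤N (m≤n+m N j)) (+-monoˡ-< N (<-≤-trans j<q q≤l)) y∈l e))
            y∈l
            (travel j<q q≤l (<-≤-trans (<-≤-trans l<i i≤N) (m≤n+m N j)) z∈j e′)
            z∈j

        base : ℕ → Bool
        base t with t <? q
        ... | yes _ = b
        ... | no _  = not b

        base-below : ∀ {t} → t < q → base t ≡ b
        base-below {t} t<q with t <? q
        ... | yes _  = refl
        ... | no t≮q = ⊥-elim (t≮q t<q)

        base≡b : ∀ {t} → base t ≡ b → t < q
        base≡b {t} eq with t <? q
        ... | yes t<q = t<q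
        ... | no _    = ⊥-elim (not-¬ refl (sym eq))

        base≢b : ∀ {t} → base t ≢ b → q ≤ t
        base≢b {t} neq with t <? q
        ... | yes _  = ⊥-elim (neq refl)
        ... | no t≮q = ≮⇒≥ t≮q

        -- The vertex whose closed out-neighbourhood in the class gets the prescribed colour: `v` in
        -- its own class, elsewhere the source of the exits of the preceding class.
        anchor : ℕ → V
        anchor zero    = v
        anchor (suc t) = proj₁ (moves (c-moves t))

        anchor-class : ∀ t → p (anchor t) ≡ c t
        anchor-class zero    = refl
        anchor-class (suc t) = proj₂ (proj₂ (moves (c-moves t)))

        local : ∀ t → GoodColouring p (anchor t) (base t)
        local t = good (anchor t) (base t)

        index : V → ℕ
        index i with anyUpTo? (λ t → i ≟ c t) N
        ... | yes (t , _) = t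
        -- A default off the cycle; `index-c` fixes the values on it.
        ... | no _        = 0

        index-c : ∀ {i t} → t < N → i ≡ c t → index i ≡ t
        index-c {i} {t} t<N eq with anyUpTo? (λ t → i ≟ c t) N
        ... | yes (s , s<N , eq′) = orbit-injective s<N t<N (trans (sym eq′) eq)
        ... | no none             = ⊥-elim (none (t , t<N , eq))

        colour : V → Bool
        colour x = proj₁ (local (index (p x))) x

        colour-c : ∀ {x t} → t < N → p x ≡ c t → colour x ≡ proj₁ (local t) x
        colour-c {x} t<N x∈t = cong (λ s → proj₁ (local s) x) (index-c t<N x∈t)

        -- Since `y` is also an exit of the predecessor `c t`, it is the anchor or dominated by it.
        entry-colour : ∀ {i t y} → i < N → suc t < N → p y ≡ c (suc t) → Exit (c i) y → colour y ≡ base (suc t)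
        entry-colour {i} {t} {y} i<N st<N y∈ e =
          trans (colour-c st<N y∈) (at-anchor (src (enters-from-predecessor i<N st<N y∈ e)))
          where
          src = proj₂ (proj₁ (proj₂ (moves (c-moves t))))
          at-anchor : y ≡ anchor (suc t) ⊎ Arc (anchor (suc t)) y → proj₁ (local (suc t)) y ≡ base (suc t)
          at-anchor (inj₁ refl) = proj₁ (proj₂ (local (suc t)))
          at-anchor (inj₂ a)    = proj₁ (proj₂ (proj₂ (local (suc t)))) (trans y∈ (sym (anchor-class (suc t)))) a

        module _ {S : V → Set} (cover : ∀ {x} → S x → ∃ λ t → t < N × p x ≡ c t) where

          out-neighbour-colour : ∀ {u} → S u → Arc v u → colour u ≡ b
          out-neighbour-colour {u} su a with cover su
          ... | zero , 0<N , u∈ = trans (colour-c 0<N u∈)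
            (trans (proj₁ (proj₂ (proj₂ (local 0))) u∈ a) (base-below 0<q))
          ... | suc t , st<N , u∈ = trans (entry-colour z<s st<N u∈ e) (base-below (≰⇒> st≱q))
            where
            e : Exit (c 0) u
            e = class-exit 0 refl (λ eq → distinct-window {0} {suc t} z<s st<N (trans (sym u∈) (sym eq))) a
            -- With the class of `v` counted as `c N`, the arc to `u` would go backward between
            -- positions from `q` on.
            st≱q : ¬ q ≤ suc t
            st≱q q≤st = forward-above-q q≤st st<N ≤-refl (subst (λ z → Exit z u) (sym returns) e) u∈

          within-class : ∀ β u → ¬ WalkIn G (λ x → p x ≡ p u × S x × colour x ≡ β) u u
          within-class β u walk with head-in walk
          ... | _ , su , _ with cover su
          ...   | t , t<N , u∈ = proj₂ (proj₂ (proj₂ (local t))) β u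
            (walk-map (λ (x≡u , _ , cx) → trans x≡u (trans u∈ (sym (anchor-class t)))
                                         , trans (sym (colour-c t<N (trans x≡u u∈))) cx) walk)

          -- The class of v is put last in the colour opposite to b: nothing of that colour
          -- in the cycle is entered from it.
          wrap : ℕ → ℕ
          wrap zero    = N
          wrap (suc t) = suc t

          wrap-≤ : ∀ {i} → i < N → wrap i ≤ N
          wrap-≤ {zero}  _   = ≤-refl
          wrap-≤ {suc i} i<N = <⇒≤ i<N

          c-wrap : ∀ i → c (wrap i) ≡ c i
          c-wrap zero    = returns
          c-wrap (suc i) = refl

          -- In colour `b`, a step between classes ends below index `q`, where no class has a
          -- backward arc. In the other colour it ends at a position from `q` on, and
          -- `forward-above-q` makes positions increase.
          acyclic : ∀ β → AcyclicIn G (λ x → S x × colour x ≡ β)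
          acyclic β with β ≟ᵇ b
          ... | yes refl = acyclic-by-position p (_< q) index crossing (within-class β)
            where
            crossing : ∀ {x y} → Step (λ x → S x × colour x ≡ b) x y → p x ≢ p y →
                       index (p y) < q × (index (p x) < q → index (p x) < index (p y))
            crossing {x} {y} ((sx , _) , (sy , cy) , a) neq with cover sx | cover sy
            ... | i , i<N , x∈ | l , l<N , y∈ =
              subst₂ (λ s t → t < q × (s < q → s < t)) (sym (index-c i<N x∈)) (sym (index-c l<N y∈))
                (below l l<N y∈ , increase)
              where
              e : Exit (c i) y
              e = class-exit i x∈ neq a
              below : ∀ l → l < N → p y ≡ c l → l < q
              below zero    _    _  = 0<q
              below (suc t) st<N y∈ = base≡b (trans (sym (entry-colour i<N st<N y∈ e)) cy)
              increase : i < q → i < l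
              increase i<q with <-cmp i l
              ... | tri< i<l _ _  = i<l
              ... | tri≈ _ refl _ = ⊥-elim (neq (trans x∈ (sym y∈)))
              ... | tri> _ _ l<i  = ⊥-elim (forward-below-q i<q (l , l<i , y , e , y∈))
          ... | no β≢b = acyclic-by-position p (q ≤_) (wrap ∘ index) crossing (within-class β)
            where
            crossing : ∀ {x y} → Step (λ x → S x × colour x ≡ β) x y → p x ≢ p y →
                       q ≤ wrap (index (p y)) × (q ≤ wrap (index (p x)) → wrap (index (p x)) < wrap (index (p y)))
            crossing {x} {y} ((sx , _) , (sy , cy) , a) neq with cover sx | cover sy
            ... | i , i<N , x∈ | l , l<N , y∈ =
              subst₂ (λ s t → q ≤ wrap t × (q ≤ wrap s → wrap s < wrap t)) (sym (index-c i<N x∈)) (sym (index-c l<N y∈))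
                (above l l<N y∈ , λ _ → increase i l i<N l<N x∈ y∈)
              where
              above : ∀ l → l < N → p y ≡ c l → q ≤ wrap l
              above zero    _    _  = <⇒≤ q<N
              above (suc t) st<N y∈ =
                base≢b (λ eq → β≢b (trans (sym cy) (trans (entry-colour i<N st<N y∈ (class-exit i x∈ neq a)) eq)))
              increase : ∀ i l → i < N → l < N → p x ≡ c i → p y ≡ c l → wrap i < wrap l
              increase zero    zero    _    _    x∈ y∈ = ⊥-elim (neq (trans x∈ (sym y∈)))
              increase (suc i) zero    si<N _    _  _  = si<N
              increase i       (suc t) i<N  st<N x∈ y∈ with <-cmp (wrap i) (suc t)
              ... | tri< lt _ _   = lt
              ... | tri≈ _ eq _   = ⊥-elim (neq (trans x∈ (trans (sym (c-wrap i)) (trans (cong c eq) (sym y∈)))))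
              ... | tri> _ _ st<i =
                ⊥-elim (forward-above-q (above (suc t) st<N y∈) st<i (wrap-≤ i<N)
                  (subst (λ z → Exit z y) (sym (c-wrap i)) (class-exit i x∈ neq a)) y∈)

      -- Merging the classes of a cycle into one.

      module Merge {r : V} (r-rep : p r ≡ r) {k : ℕ} (0<k : 0 < k) (period : Period next r k) where
        open PeriodProperties next period

        OnCycle : V → Set
        OnCycle i = ∃ λ t → t < suc k × orbit t ≡ i

        onCycle? : ∀ i → Dec (OnCycle i)
        onCycle? i = anyUpTo? (λ t → orbit t ≟ i) (suc k)

        p′ : V → V
        p′ x with onCycle? (p x)
        ... | yes _ = r
        ... | no _  = p x

        on : ∀ {x} → OnCycle (p x) → p′ x ≡ r
        on {x} x∈ with onCycle? (p x)
        ... | yes _  = refl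
        ... | no x∉ = ⊥-elim (x∉ x∈)

        off : ∀ {x} → ¬ OnCycle (p x) → p′ x ≡ p x
        off {x} x∉ with onCycle? (p x)
        ... | yes x∈ = ⊥-elim (x∉ x∈)
        ... | no _   = refl

        r-on : OnCycle r
        r-on = 0 , z<s , refl

        p′-on : ∀ {x} → p′ x ≡ r → OnCycle (p x)
        p′-on {x} eq with onCycle? (p x)
        ... | yes x∈ = x∈
        ... | no _   = subst OnCycle (sym eq) r-on

        same-class : ∀ {x y} → p x ≡ p y → p′ x ≡ p′ y
        same-class {x} {y} eq with onCycle? (p x) | onCycle? (p y)
        ... | yes _  | yes _  = refl
        ... | no _   | no _   = eq
        ... | yes x∈ | no y∉  = ⊥-elim (y∉ (subst OnCycle eq x∈))
        ... | no x∉  | yes y∈ = ⊥-elim (x∉ (subst OnCycle (sym eq) y∈))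

        idempotent′ : ∀ x → p′ (p′ x) ≡ p′ x
        idempotent′ x = by-cases (onCycle? (p x))
          where
          by-cases : Dec (OnCycle (p x)) → p′ (p′ x) ≡ p′ x
          by-cases (yes x∈) rewrite on {x} x∈ = on (subst OnCycle (sym r-rep) r-on)
          by-cases (no x∉)  rewrite off {x} x∉ = trans (same-class (idempotent x)) (off x∉)

        -- The class of `y` is off the cycle, so the exception in `slide` never occurs.
        all-around : ∀ {t y} m → ¬ OnCycle (p y) → Exit (orbit t) y → Exit (orbit (m + t)) y
        all-around zero    _  e = e
        all-around {t} (suc m) y∉ e =
          slide (orbit-rep r-rep (m + t)) (all-around m y∉ e)
            (λ eq → case orbit-reduce (suc m + t) of λ (s , s<N , eq′) → y∉ (s , s<N , trans eq′ (sym eq)))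

        uniform′ : ∀ {x x′ y} → p′ x ≡ p′ x′ → p′ y ≢ p′ x → Arc x y → Arc x′ y
        uniform′ {x} {x′} {y} eq neq a = by-cases (onCycle? (p x))
          where
          by-cases : Dec (OnCycle (p x)) → Arc x′ y
          by-cases (no x∉) = uniform (trans (sym (off x∉)) (trans eq (off x′∉))) (neq ∘ same-class) a
            where
            x′∉ : ¬ OnCycle (p x′)
            x′∉ x′∈ = x∉ (p′-on (trans eq (on x′∈)))
          -- The tail goes to the representative of its class, then along the cycle to the class of
          -- `x′`, then to `x′` itself.
          by-cases (yes x∈@(t , _ , t≡)) with p′-on {x′} (trans (sym eq) (on x∈))
          ... | s , s<N , s≡ =
            uniform (idempotent x′) (λ e → y∉ (s , s<N , trans s≡ (trans (sym (idempotent x′)) (sym e))))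
              (proj₁ (subst (λ z → Exit z y) reach (all-around m y∉ start)))
            where
            y∉ : ¬ OnCycle (p y)
            y∉ y∈ = neq (trans (on y∈) (sym (on x∈)))
            start : Exit (orbit t) y
            start = subst (λ z → Exit z y) (sym t≡) (from-rep (a , neq ∘ same-class))
            m = proj₁ (orbit-shift t s)
            reach : orbit (m + t) ≡ p x′
            reach = trans (sym (orbit-fold t m)) (trans (proj₂ (orbit-shift t s)) s≡)

        good′ : ∀ v b → GoodColouring p′ v b
        good′ v b = by-cases (onCycle? (p v))
          where
          by-cases : Dec (OnCycle (p v)) → GoodColouring p′ v b
          by-cases (no v∉) with good v b
          ... | col , col-v , col-out , col-acyclic =
            col , col-v , (λ eq → col-out (narrow eq)) ,
            λ β u walk → col-acyclic β u (walk-map (λ (eq , cx) → narrow eq , cx) walk)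
            where
            narrow : ∀ {x} → p′ x ≡ p′ v → p x ≡ p v
            narrow {x} eq = trans (sym (off x∉)) (trans eq (off v∉))
              where
              x∉ : ¬ OnCycle (p x)
              x∉ x∈ = v∉ (p′-on (trans (sym eq) (on x∈)))
          -- The cycle is restarted at the class of `v`, which becomes `c 0`.
          by-cases (yes v∈@(s , _ , s≡)) =
            colour , trans (colour-c z<s refl) (trans (proj₁ (proj₂ (local 0))) (base-below 0<q)) ,
            out-neighbour-colour cover , acyclic cover
            where
            period-v : Period next (p v) k
            period-v = subst (λ z → Period next z k) s≡ (shifted s)
            open Cycle v b 0<k period-v
            cover : ∀ {x} → p′ x ≡ p′ v → ∃ λ t → t < suc k × p x ≡ fold (p v) next t
            cover {x} eq with p′-on {x} (trans eq (on v∈))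
            ... | u , _ , u≡ with orbit-shift s u
            ...   | m , m≡ with PeriodProperties.orbit-reduce next period-v m
            ...     | t , t<N , t≡ = t , t<N ,
              trans (sym u≡) (trans (sym m≡) (trans (cong (λ z → fold z next m) s≡) (sym t≡)))

        merged : ModularPartition
        merged = record { p = p′ ; idempotent = idempotent′ ; uniform = uniform′ ; good = good′ }

        -- Only representatives fixed by `p′` are kept; `next r` drops out, as it is merged into `r`
        -- and differs from it by `0 < k`.
        fewer-classes : ∀ {classes} → (∀ x → p x ∈ classes) →
                        ∃ λ classes′ → length classes′ < length classes × (∀ x → p′ x ∈ classes′)
        fewer-classes {classes} listed =
          filter fixed? classes ,
          filter-notAll fixed? classes (lose (subst (_∈ classes) (orbit-rep r-rep 1) (listed (next r))) lost) ,
          λ x → ∈-filter⁺ fixed? (kept x) (idempotent′ x)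
          where
          fixed? = λ i → p′ i ≟ i
          lost : p′ (next r) ≢ next r
          lost eq = distinct 0 0<k (trans (sym eq) (on on-cycle))
            where
            on-cycle : OnCycle (p (next r))
            on-cycle = 1 , s<s 0<k , sym (orbit-rep r-rep 1)
          kept : ∀ x → p′ x ∈ classes
          kept x with onCycle? (p x)
          ... | yes _ = subst (_∈ classes) r-rep (listed r)
          ... | no _  = listed x

      -- Colouring when every orbit of `next` ends in a sink.

      module Sinks (sink : ∀ i → p i ≡ i → next (fold i next order) ≡ fold i next order) where

        Reaches : V → V → Set
        Reaches i j = ∃ λ t → fold i next t ≡ j

        reaches-trans : ∀ {i j l} → Reaches i j → Reaches j l → Reaches i l
        reaches-trans {i} (s , refl) (t , refl) = t + s , fold-+ i next t

        stuck : ∀ {i} → next i ≡ i → ∀ t → fold i next t ≡ i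
        stuck eq zero    = refl
        stuck eq (suc t) = trans (cong next (stuck eq t)) eq

        -- Induction on the steps left to a sink: an arc that does not enter the next class slides
        -- to it, and a sink has no exits, so the arc's class is met on the way.
        exit-reaches : ∀ {i y} m → p i ≡ i → next (fold i next m) ≡ fold i next m → Exit i y → Reaches i (p y)
        exit-reaches zero    pi≡i end e = ⊥-elim (exit-moves pi≡i e end)
        exit-reaches {i} {y} (suc m) pi≡i end e with p y ≟ next i
        ... | yes eq = 1 , sym eq
        ... | no neq = reaches-trans (1 , refl)
          (exit-reaches m (next-rep pi≡i) (subst (λ z → next z ≡ z) (front m) end) (slide pi≡i e neq))
          where
          front : ∀ m → fold i next (suc m) ≡ fold (next i) next m
          front m = trans (cong (fold i next) (+-comm 1 m)) (fold-+ i next m)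

        crossing-reaches : ∀ {x y} → Arc x y → Reaches (p x) (p y)
        crossing-reaches {x} {y} a with p y ≟ p x
        ... | yes eq = 0 , sym eq
        ... | no neq = exit-reaches order (idempotent x) (sink (p x) (idempotent x)) (from-rep (a , neq))

        star-reaches : ∀ {S x y} → Star (Step S) x y → Reaches (p x) (p y)
        star-reaches ε = 0 , refl
        star-reaches ((_ , _ , a) ◅ rest) = reaches-trans (crossing-reaches a) (star-reaches rest)

        -- Going round the loop `order` times takes at least `order` steps, so it ends at a fixed
        -- point, which is `i`.
        loop-fixed : ∀ {i} t → p i ≡ i → fold i next (suc t) ≡ i → next i ≡ i
        loop-fixed {i} t pi≡i loop =
          subst (λ z → next z ≡ z) back (subst (λ z → next z ≡ z) (sym still) (sink i pi≡i))
          where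
          repeat : ∀ a → fold i next (a * suc t) ≡ i
          repeat zero    = refl
          repeat (suc a) = trans (fold-+ i next (suc t)) (trans (cong (λ z → fold z next (suc t)) (repeat a)) loop)
          back : fold i next (order * t + order) ≡ i
          back = trans (cong (fold i next) (trans (+-comm (order * t) order) (sym (*-suc order t)))) (repeat order)
          still : fold i next (order * t + order) ≡ fold i next order
          still = trans (fold-+ i next (order * t)) (stuck (sink i pi≡i) (order * t))

        reaches-antisym : ∀ {i j} → p i ≡ i → Reaches i j → Reaches j i → i ≡ j
        reaches-antisym pi≡i (zero , refl) _ = refl
        reaches-antisym {i} pi≡i (suc s , refl) (t , back) = sym (stuck fixed (suc s))
          where
          fixed : next i ≡ i
          fixed = loop-fixed (t + s) pi≡i
            (trans (cong (fold i next) (sym (+-suc t s))) (trans (fold-+ i next t) back))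

        colour : V → Bool
        colour x = proj₁ (good (p x) true) x

        -- A closed walk with a step between classes would make two distinct classes reach each
        -- other along `next`.
        colour-acyclic : ∀ β → AcyclicIn G (λ x → colour x ≡ β)
        colour-acyclic β u walk with closed-walk p walk
        ... | inj₁ inside = proj₂ (proj₂ (proj₂ (good (p u) true))) β u
          (walk-map (λ {x} (eq , cx) → trans eq (sym (idempotent u))
                                       , trans (cong (λ i → proj₁ (good i true) x) (sym eq)) cx) inside)
        ... | inj₂ (x , y , (_ , _ , a) , neq , back) =
          neq (reaches-antisym (idempotent x) (crossing-reaches a) (star-reaches back))

    -- Repeated merging and the theorem.

    BoolColouring : Set
    BoolColouring = Σ (V → Bool) λ col → ∀ β → AcyclicIn G (λ x → col x ≡ β)

    -- An orbit not settled after `order` steps is by then on a cycle of at least two classes, whose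
    -- merging shortens the list of representatives.
    colour-partition : (π : ModularPartition) (classes : List V) → (∀ x → ModularPartition.p π x ∈ classes) →
                       Acc _<_ (length classes) → BoolColouring
    colour-partition π classes listed (acc smaller) = by-cases (any? unsettled?)
      where
      open Quotient π
      end : V → V
      end i = fold (p i) next order
      unsettled? = λ i → ¬? (next (end i) ≟ end i)
      by-cases : Dec (∃ λ i → next (end i) ≢ end i) → BoolColouring
      by-cases (no settled) = colour , colour-acyclic
        where
        settles : ∀ i → p i ≡ i → next (fold i next order) ≡ fold i next order
        settles i pi≡i with next (end i) ≟ end i
        ... | yes eq = subst (λ j → next (fold j next order) ≡ fold j next order) pi≡i eq
        ... | no neq = ⊥-elim (settled (i , neq))
        open Sinks settles
      by-cases (yes (i , unsettled)) with eventually-periodic next (p i)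
      ... | zero , period = ⊥-elim (unsettled (Period.returns period))
      ... | suc k , period with Merge.fewer-classes (orbit-rep (idempotent i) order) z<s period listed
      ...   | classes′ , shorter , listed′ =
        colour-partition (Merge.merged (orbit-rep (idempotent i) order) z<s period) classes′ listed′ (smaller shorter)

theorem8p4p2 : (G : Digraph) → Oriented G → LocallyOutTransitive G → DichromaticAtMost G 2
theorem8p4p2 G oriented lot
  with colour-partition G oriented lot (discrete G oriented lot) (allFin _) ∈-allFin (<-wellFounded _)
... | col , acyclic = (λ v → toFin (col v)) , λ i v walk → acyclic (fromFin i) v (walk-map G (from≡ i) walk)
  where
  toFin : Bool → Fin 2
  toFin false = zero
  toFin true  = suc zero
  fromFin : Fin 2 → Bool
  fromFin zero    = false
  fromFin (suc _) = true
  from≡ : ∀ i {b} → toFin b ≡ i → b ≡ fromFin i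
  from≡ _ {false} refl = refl
  from≡ _ {true}  refl = refl
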